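{- Let $G$ be a finite simple connected graph with $n\geq 2$ vertices and $m$ edges. Then $\mathrm{dem}(G)\geq \mathrm{arb}(G)$, and thus $\mathrm{dem}(G)\geq \frac{m}{n-1}$ and $\mathrm{dem}(G)\geq\frac{\omega(G)}{2}$.
   Context: $d_G(x,y)$ denotes the distance between vertices $x,y$ in $G$ (equal to $\infty$ if $x$ and $y$ are in different components), and $G-e$ is the graph obtained from $G$ by deleting the edge $e$. An edge $e$ of $G$ is monitored by a vertex $x$ if there is a vertex $y$ of $G$ with $d_G(x,y)\neq d_{G-e}(x,y)$ (equivalently, $e$ belongs to all shortest paths between $x$ and $y$ in $G$). A set $M\subseteq V(G)$ is distance-edge-monitoring if every edge of $G$ is monitored by some vertex of $M$, and $\mathrm{dem}(G)$ is the smallest size of a distance-edge-monitoring set of $G$. The arboricity $\mathrm{arb}(G)$ is the smallest number of sets into which $E(G)$ can be partitioned so that each set induces a forest. The clique number $\omega(G)$ is the size of a largest clique in $G$. -}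

module Defs where

open import Data.Bool using (true)
open import Data.Fin using (Fin; zero; suc; toℕ; fromℕ<)
open import Data.Fin.Properties using (any?; all?; injective⇒≤; toℕ-fromℕ<; toℕ<n; _≟_)
open import Data.Fin.Subset using (Subset; inside; outside; ⊤; ∣_∣; _∈_; _∉_; _─_; _-_; ⁅_⁆) renaming (⊥ to ∅)
open import Data.Fin.Subset.Properties using (_∈?_; ∈⊤; x∈⁅x⁆; ∣p∣≤n; anySubset?; ∉⊥)
open import Data.List using (List; []; _∷_; length; lookup)
open import Data.List.Membership.Propositional using () renaming (_∈_ to _∈ₗ_)
open import Data.List.Membership.Propositional.Properties using (∈-lookup)
open import Data.List.Relation.Unary.All as All using (All; []; _∷_)
open import Data.List.Relation.Unary.All.Properties using (¬Any⇒All¬)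
open import Data.List.Relation.Unary.AllPairs using ([]; _∷_)
open import Data.List.Relation.Unary.Any using (here; there)
open import Data.List.Relation.Unary.Unique.Propositional using (Unique)
import Data.List.Membership.DecPropositional as DecMembership
import Data.List.Relation.Unary.Unique.DecPropositional as DecUnique
import Data.Maybe.Properties as Maybe
open import Data.Nat using (ℕ; zero; suc; _∸_; _≤_; _<_; z≤n; s≤s; NonZero; >-nonZero)
open import Data.Nat.Properties using (_≤?_; ≤-reflexive; ≤-trans; ≤∧≢⇒<; ≤-pred; n≤0⇒n≡0; m<n⇒0<n∸m) renaming (_≟_ to _≟ℕ_)
open import Data.Product using (Σ; ∃; ∃-syntax; _×_; _,_; proj₁; proj₂)
open import Data.Product.Properties using (≡-dec)
open import Data.Sum using (_⊎_; inj₁; inj₂)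
open import Data.Unit using (tt) renaming (⊤ to Unit)
open import Data.Vec as Vec using (Vec; []; _∷_; here; there)
open import Data.Vec.Properties using (lookup-map; lookup-allFin; []=⇒lookup)
open import Function using (_∘_)
open import Relation.Binary.PropositionalEquality using (_≡_; _≢_; refl; sym; trans; cong; subst; module ≡-Reasoning)
open import Relation.Nullary using (¬_; Dec; yes; no; does; contradiction)
open import Relation.Nullary.Construct.Add.Supremum using (_⁺; [_]) renaming (⊤⁺ to ∞)
open import Relation.Nullary.Decidable using (map′; ¬?; _×-dec_; _⊎-dec_; _→-dec_)
open import Relation.Unary using (Decidable)

IsMinimum IsMaximum : (ℕ → Set) → ℕ → Set
IsMinimum P k = P k × (∀ {j} → P j → k ≤ j)
IsMaximum P k = P k × (∀ {j} → P j → j ≤ k)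

minimum : {P : ℕ → Set} → Decidable P → ∃ P → ∃ (IsMinimum P)
minimum P? (k , pk) = search P? k pk
  where
  search : {P : ℕ → Set} → Decidable P → ∀ k → P k → ∃ (IsMinimum P)
  search P? k pk with P? 0
  search P? k       pk | yes p0 = 0 , p0 , λ _ → z≤n
  search P? zero    pk | no ¬p0 = contradiction pk ¬p0
  search {P} P? (suc k) pk | no ¬p0 with search (P? ∘ suc) k pk
  ... | l , pl , least = suc l , pl , λ {j} → above j
    where
    above : ∀ j → P j → suc l ≤ j
    above zero    p0 = contradiction p0 ¬p0
    above (suc j) pj = s≤s (least pj)

maximum : {P : ℕ → Set} → Decidable P → ∃ P → ∀ b → (∀ {j} → P j → j ≤ b) → ∃ (IsMaximum P)
maximum {P} P? (k , pk) zero    bound = 0 , subst P (n≤0⇒n≡0 (bound pk)) pk , bound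
maximum {P} P? wit      (suc b) bound with P? (suc b)
... | yes p = suc b , p , bound
... | no ¬p = maximum P? wit b λ pj →
  ≤-pred (≤∧≢⇒< (bound pj) λ j≡ → ¬p (subst P j≡ pj))

-- A simple graph on the vertices Fin n, whose m edges are labelled by Fin m.
-- The order in which `ends e` lists the two ends of e carries no information.
record Graph (n m : ℕ) : Set where
  field
    ends : Fin m → Fin n × Fin n

  Joins : Fin m → Fin n → Fin n → Set
  Joins e x y = ends e ≡ (x , y) ⊎ ends e ≡ (y , x)

  field
    loopless   : ∀ {e x} → ¬ Joins e x x
    noParallel : ∀ {e f x y} → Joins e x y → Joins f x y → e ≡ f

  joins? : ∀ e x y → Dec (Joins e x y)
  joins? e x y = ≡-dec _≟_ _≟_ (ends e) (x , y) ⊎-dec ≡-dec _≟_ _≟_ (ends e) (y , x)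

module _ {n m : ℕ} (G : Graph n m) where
  open Graph G

  -- A set S of edges stands for the spanning subgraph (V(G), S) in the
  -- notions below: G itself is ⊤, and G - e is ⊤ - e.

  Adjacent : Subset m → Fin n → Fin n → Set
  Adjacent S x y = ∃[ e ] (e ∈ S × Joins e x y)

  data Walk (S : Subset m) : Fin n → Fin n → ℕ → Set where
    ε   : ∀ {x} → Walk S x x 0
    _◅_ : ∀ {x y z k} → Adjacent S x y → Walk S y z k → Walk S x z (suc k)

  vertices : ∀ {S x y k} → Walk S x y k → List (Fin n)
  vertices {x = x} ε       = x ∷ []
  vertices {x = x} (_ ◅ w) = x ∷ vertices w

  Connected : Set
  Connected = ∀ x y → ∃[ k ] Walk ⊤ x y k

  IsDistance : Subset m → Fin n → Fin n → ℕ ⁺ → Set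
  IsDistance S x y [ d ] = IsMinimum (Walk S x y) d
  IsDistance S x y ∞     = ¬ (∃[ k ] Walk S x y k)

  -- A path on at least three vertices whose last vertex is adjacent to its first.
  HasCycle : Subset m → Set
  HasCycle S = ∃[ x ] ∃[ y ] ∃[ k ] Σ (Walk S x y k) λ w →
    Unique (vertices w) × 2 ≤ k × Adjacent S y x

  IsForest : Subset m → Set
  IsForest S = ¬ HasCycle S

  -- The class function assigns to each edge the index of its part.
  part : ∀ {k} → Vec (Fin k) m → Fin k → Subset m
  part class i = Vec.map (λ j → does (j ≟ i)) class

  ForestPartition : ℕ → Set
  ForestPartition k = Σ (Vec (Fin k) m) λ class → ∀ i → IsForest (part class i)

  IsClique : Subset n → Set
  IsClique C = ∀ x y → x ∈ C → y ∈ C → x ≢ y → Adjacent ⊤ x y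

  CliqueOfSize : ℕ → Set
  CliqueOfSize k = ∃[ C ] (∣ C ∣ ≡ k × IsClique C)

  adjacent? : ∀ S x y → Dec (Adjacent S x y)
  adjacent? S x y = any? λ e → (e ∈? S) ×-dec joins? e x y

  walkWith? : ∀ {S} {Q : List (Fin n) → Set} → Decidable Q → ∀ k x y →
              Dec (Σ (Walk S x y k) (Q ∘ vertices))
  walkWith? Q? zero x y with x ≟ y
  ... | no x≢y   = no λ { (ε , _) → x≢y refl }
  ... | yes refl = map′ (ε ,_) (λ { (ε , q) → q }) (Q? (x ∷ []))
  walkWith? {S} Q? (suc k) x y =
    map′ (λ (_ , a , w , q) → a ◅ w , q) (λ { (a ◅ w , q) → _ , a , w , q })
      (any? λ z → adjacent? S x z ×-dec walkWith? (Q? ∘ (x ∷_)) k z y)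

  walk? : ∀ {S} x y → Decidable (Walk S x y)
  walk? x y k = map′ proj₁ (_, tt) (walkWith? {Q = λ _ → Unit} (λ _ → yes tt) k x y)

  length-vertices : ∀ {S x y k} (w : Walk S x y k) → length (vertices w) ≡ suc k
  length-vertices ε       = refl
  length-vertices (_ ◅ w) = cong suc (length-vertices w)

  lookup-injective : ∀ {xs : List (Fin n)} → Unique xs →
                     ∀ {i j} → lookup xs i ≡ lookup xs j → i ≡ j
  lookup-injective (_ ∷ _) {zero} {zero} _ = refl
  lookup-injective {_ ∷ xs} (x∉xs ∷ _) {zero} {suc j} eq =
    contradiction eq (All.lookup x∉xs (∈-lookup {xs = xs} j))
  lookup-injective {_ ∷ xs} (x∉xs ∷ _) {suc i} {zero} eq =
    contradiction (sym eq) (All.lookup x∉xs (∈-lookup {xs = xs} i))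
  lookup-injective (_ ∷ u) {suc i} {suc j} eq = cong suc (lookup-injective u eq)

  path-length : ∀ {S x y k} (w : Walk S x y k) → Unique (vertices w) → k < n
  path-length w u = subst (_≤ n) (length-vertices w) (injective⇒≤ (lookup-injective u))

  Path : Subset m → Fin n → Fin n → Set
  Path S x y = ∃[ k ] Σ (Walk S x y k) (Unique ∘ vertices)

  dropTo : ∀ {S x y z k} (w : Walk S x y k) → Unique (vertices w) → z ∈ₗ vertices w → Path S z y
  dropTo ε       u       (here refl) = 0 , ε , u
  dropTo (a ◅ w) u       (here refl) = _ , a ◅ w , u
  dropTo (_ ◅ w) (_ ∷ u) (there z∈w) = dropTo w u z∈w

  toPath : ∀ {S x y k} → Walk S x y k → Path S x y
  toPath ε = 0 , ε , [] ∷ []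
  toPath {x = x} (a ◅ w) with toPath w
  ... | l , p , u with DecMembership._∈?_ _≟_ x (vertices p)
  ...   | yes x∈p = dropTo p u x∈p
  ...   | no  x∉p = suc l , a ◅ p , ¬Any⇒All¬ _ x∉p ∷ u

  anyBelow? : {P : ℕ → Set} → Decidable P → Dec (∃[ k ] (k < n × P k))
  anyBelow? {P} P? = map′
    (λ (i , p) → toℕ i , toℕ<n i , p)
    (λ (_ , k<n , p) → fromℕ< k<n , subst P (sym (toℕ-fromℕ< k<n)) p)
    (any? (P? ∘ toℕ))

  reachable? : ∀ S x y → Dec (∃[ k ] Walk S x y k)
  reachable? S x y = map′
    (λ (k , _ , w) → k , w)
    (λ (_ , w) → let k , p , u = toPath w in k , path-length p u , p)
    (anyBelow? (walk? x y))

  distance-exists : ∀ S x y → ∃ (IsDistance S x y)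
  distance-exists S x y with reachable? S x y
  ... | yes w = let d , isMin = minimum (walk? x y) w in [ d ] , isMin
  ... | no ¬w = ∞ , ¬w

  distance : Subset m → Fin n → Fin n → ℕ ⁺
  distance S x y = proj₁ (distance-exists S x y)

  Monitors : Fin n → Fin m → Set
  Monitors x e = ∃[ y ] distance ⊤ x y ≢ distance (⊤ - e) x y

  IsDistanceEdgeMonitoring : Subset n → Set
  IsDistanceEdgeMonitoring M = ∀ e → ∃[ x ] (x ∈ M × Monitors x e)

  MonitoringSetOfSize : ℕ → Set
  MonitoringSetOfSize k = ∃[ M ] (∣ M ∣ ≡ k × IsDistanceEdgeMonitoring M)

  monitors? : ∀ x e → Dec (Monitors x e)
  monitors? x e = any? λ y → ¬? (Maybe.≡-dec _≟ℕ_ (distance ⊤ x y) (distance (⊤ - e) x y))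

  monitoringSetOfSize? : Decidable MonitoringSetOfSize
  monitoringSetOfSize? k = anySubset? λ M →
    (∣ M ∣ ≟ℕ k) ×-dec all? λ e → any? λ x → (x ∈? M) ×-dec monitors? x e

  x∈p─q⇒x∉q : ∀ {l x} (p q : Subset l) → x ∈ p ─ q → x ∉ q
  x∈p─q⇒x∉q (_ ∷ _) (inside ∷ _) () here
  x∈p─q⇒x∉q (_ ∷ p) (inside  ∷ q) (there x∈) (there x∈q) = x∈p─q⇒x∉q p q x∈ x∈q
  x∈p─q⇒x∉q (_ ∷ p) (outside ∷ q) (there x∈) (there x∈q) = x∈p─q⇒x∉q p q x∈ x∈q

  end-monitors : ∀ e → Monitors (proj₁ (ends e)) e
  end-monitors e = v , λ eq → differ (proj₂ (distance-exists ⊤ u v))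
    (subst (IsDistance (⊤ - e) u v) (sym eq) (proj₂ (distance-exists (⊤ - e) u v)))
    where
    u v : Fin n
    u = proj₁ (ends e)
    v = proj₂ (ends e)
    edge : Walk ⊤ u v 1
    edge = (e , ∈⊤ , inj₁ refl) ◅ ε
    differ : ∀ {d} → IsDistance ⊤ u v d → ¬ IsDistance (⊤ - e) u v d
    differ {∞}     ¬w        _ = ¬w (1 , edge)
    differ {[ d ]} (_ , min) (w , _) = short w (min edge)
      where
      short : ∀ {d} → Walk (⊤ - e) u v d → ¬ (d ≤ 1)
      short w z≤n = loop w refl refl
        where
        loop : ∀ {x y} → Walk (⊤ - e) x y 0 → x ≡ u → ¬ (y ≡ v)
        loop ε x≡u x≡v = loopless {e} {u} (inj₁ (cong (u ,_) (trans (sym x≡v) x≡u)))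
      short ((f , f∈ , j) ◅ ε) (s≤s z≤n) with refl ← noParallel {f} {e} j (inj₁ refl) =
        x∈p─q⇒x∉q ⊤ ⁅ e ⁆ f∈ (x∈⁅x⁆ e)

  dem-exists : ∃ (IsMinimum MonitoringSetOfSize)
  dem-exists = minimum monitoringSetOfSize?
    (_ , ⊤ , refl , λ e → _ , ∈⊤ , end-monitors e)

  dem : ℕ
  dem = proj₁ dem-exists

  hasCycle? : ∀ S → Dec (HasCycle S)
  hasCycle? S = map′
    (λ (x , y , k , _ , (w , u) , rest) → x , y , k , w , u , rest)
    (λ (x , y , k , w , u , rest) → x , y , k , path-length w u , (w , u) , rest)
    (any? λ x → any? λ y → anyBelow? λ k →
      walkWith? (DecUnique.unique? _≟_) k x y ×-dec (2 ≤? k) ×-dec adjacent? S y x)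

  anyVec? : ∀ {k l} {P : Vec (Fin k) l → Set} → Decidable P → Dec (∃ P)
  anyVec? {l = zero}  P? = map′ ([] ,_) (λ { ([] , p) → p }) (P? [])
  anyVec? {l = suc l} P? = map′
    (λ (i , v , p) → i ∷ v , p) (λ { (i ∷ v , p) → i , v , p })
    (any? λ i → anyVec? (P? ∘ (i ∷_)))

  forestPartition? : Decidable ForestPartition
  forestPartition? k = anyVec? λ class → all? λ i → ¬? (hasCycle? (part class i))

  ∈-part-allFin : ∀ {e i} → e ∈ part (Vec.allFin m) i → e ≡ i
  ∈-part-allFin {e} {i} e∈ with e ≟ i | does≡
    where
    does≡ : does (e ≟ i) ≡ true
    does≡ = begin
      does (e ≟ i)                                ≡⟨ cong (λ j → does (j ≟ i)) (lookup-allFin e) ⟨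
      does (Vec.lookup (Vec.allFin m) e ≟ i)      ≡⟨ lookup-map e _ (Vec.allFin m) ⟨
      Vec.lookup (part (Vec.allFin m) i) e        ≡⟨ []=⇒lookup e∈ ⟩
      true                                        ∎
      where open ≡-Reasoning
  ... | yes e≡i | _  = e≡i
  ... | no  _   | ()

  oneEdgeForest : ∀ {S i} → (∀ {e} → e ∈ S → e ≡ i) → IsForest S
  oneEdgeForest {S} {i} only (_ , _ , _ , a ◅ (b ◅ w) , (x≢y ∷ x∉w) ∷ _ , _ , _) =
    consecutive a b x≢y (start≢ w x∉w)
    where
    start≢ : ∀ {x y z k} (w : Walk S y z k) → All (x ≢_) (vertices w) → x ≢ y
    start≢ ε       (x≢y ∷ _) = x≢y
    start≢ (_ ◅ _) (x≢y ∷ _) = x≢y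
    consecutive : ∀ {x y z} → Adjacent S x y → Adjacent S y z → x ≢ y → ¬ (x ≢ z)
    consecutive (e , e∈ , p) (f , f∈ , q) x≢y x≢z with refl ← only e∈ | refl ← only f∈ with p | q
    ... | inj₁ p | inj₁ q = x≢y (cong proj₁ (trans (sym p) q))
    ... | inj₁ p | inj₂ q = x≢z (cong proj₁ (trans (sym p) q))
    ... | inj₂ p | inj₁ q = x≢z (cong proj₂ (trans (sym p) q))
    ... | inj₂ p | inj₂ q = x≢y (cong proj₂ (trans (sym p) q))
  oneEdgeForest only (_ , _ , _ , ε , _ , () , _)
  oneEdgeForest only (_ , _ , _ , _ ◅ ε , _ , s≤s () , _)

  arb-exists : ∃ (IsMinimum ForestPartition)
  arb-exists = minimum forestPartition?
    (m , Vec.allFin m , λ i → oneEdgeForest ∈-part-allFin)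

  arb : ℕ
  arb = proj₁ arb-exists

  cliqueOfSize? : Decidable CliqueOfSize
  cliqueOfSize? k = anySubset? λ C → (∣ C ∣ ≟ℕ k) ×-dec
    all? λ x → all? λ y → (x ∈? C) →-dec (y ∈? C) →-dec ¬? (x ≟ y) →-dec adjacent? ⊤ x y

  ω-exists : ∃ (IsMaximum CliqueOfSize)
  ω-exists = maximum cliqueOfSize?
    (_ , ∅ , refl , λ _ _ x∈∅ → contradiction x∈∅ ∉⊥)
    n (λ (C , ∣C∣≡j , _) → ≤-trans (≤-reflexive (sym ∣C∣≡j)) (∣p∣≤n C))

  ω : ℕ
  ω = proj₁ ω-exists

n∸1-nonZero : ∀ {n} → 2 ≤ n → NonZero (n ∸ 1)
n∸1-nonZero 2≤n = >-nonZero (m<n⇒0<n∸m 2≤n)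

{-# OPTIONS --safe #-}

-- Let M be a distance-edge-monitoring set of size dem(G), and for x in M call an
-- edge x-monitored if x monitors it.  If two edges uv and u'v are such that neither
-- u nor u' is farther from x than v, then a shortest path from x that uses the
-- one with the farther of u and u' can be rerouted through the other, so that edge
-- is not x-monitored.  Hence no vertex is a weak local maximum of the distance
-- from x along two x-monitored edges.  A cycle has such a vertex, so the x-monitored
-- edges form a forest, and dem(G) such forests cover E(G).  Sending an x-monitored
-- edge to its end far from x, which is never x itself, gives m ≤ dem(G) (n - 1).
-- The x-monitored edges inside a clique form a star around the unique
-- vertex of the clique nearest to x, so all vertices of a clique but at most one are
-- centres of stars, which gives ω(G) ≤ dem(G) + 1.

module Submission where

open import Defs
open import Data.Bool using (true)
open import Data.Fin using (Fin; zero; suc; punchIn; punchOut; combine)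
open import Data.Fin.Properties using (_≟_; any?; all?; injective⇒≤; suc-injective;
  punchOut-injective; punchIn-injective; punchInᵢ≢i; combine-injective; ¬∀⟶∃¬)
open import Data.Fin.Subset using (Subset; inside; outside; ⊤; ∣_∣; _∈_; _⊆_; _-_)
open import Data.Fin.Subset.Properties using (∈⊤; x∈p∧x≢y⇒x∈p-y)
open import Data.Integer using (+_; +≤+)
open import Data.List.Membership.Propositional using () renaming (_∈_ to _∈ₗ_)
open import Data.List.Relation.Unary.All as All using ()
open import Data.List.Relation.Unary.AllPairs using (_∷_)
open import Data.List.Relation.Unary.Any using (here; there)
open import Data.List.Relation.Unary.Unique.Propositional using (Unique)
open import Data.Nat using (ℕ; zero; suc; _*_; _≤_; _<_; _∸_; z≤n; s≤s)
open import Data.Nat.Properties using (≤-refl; ≤-reflexive; ≤-trans; ≤-total; ≤-antisym;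
  <-trans; <⇒≤; <-irrefl; m≤n⇒m≤1+n; ≰⇒>; _≤?_; _<?_;
  <-cmp; *-identityʳ; *-comm; +-mono-≤; m≤m+n)
import Data.Integer as ℤ
import Data.Integer.Properties as ℤ
open import Data.Product using (∃; ∃-syntax; _×_; _,_; proj₁; proj₂)
open import Data.Rational using (_/_) renaming (_≤_ to _≤ℚ_)
import Data.Rational.Properties as ℚ
import Data.Rational.Unnormalised as ℚᵘ
import Data.Rational.Unnormalised.Properties as ℚᵘ
open import Data.Sum using (_⊎_; inj₁; inj₂; swap)
open import Data.Vec as Vec using (_∷_; here; there)
open import Data.Vec.Properties using (lookup-map; lookup∘tabulate; []=⇒lookup)
open import Function using (_∘_; Injective)
open import Relation.Binary.Definitions using (tri<; tri≈; tri>)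
open import Relation.Binary.PropositionalEquality
  using (_≡_; _≢_; refl; sym; trans; cong; subst; subst₂; module ≡-Reasoning)
open import Relation.Nullary using (¬_; Dec; yes; no; does; contradiction)
open import Relation.Nullary.Construct.Add.Supremum using ([_]) renaming (⊤⁺ to ∞)
open import Relation.Nullary.Decidable using (¬?; _→-dec_)

-- Enumeration of subsets and comparison of fractions.

nth : ∀ {n} (p : Subset n) → Fin ∣ p ∣ → Fin n
nth (inside  ∷ p) zero    = zero
nth (inside  ∷ p) (suc i) = suc (nth p i)
nth (outside ∷ p) i       = suc (nth p i)

nth∈ : ∀ {n} (p : Subset n) i → nth p i ∈ p
nth∈ (inside  ∷ p) zero    = here
nth∈ (inside  ∷ p) (suc i) = there (nth∈ p i)
nth∈ (outside ∷ p) i       = there (nth∈ p i)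

nth-injective : ∀ {n} (p : Subset n) → Injective _≡_ _≡_ (nth p)
nth-injective (inside  ∷ p) {zero}  {zero}  _  = refl
nth-injective (inside  ∷ p) {suc i} {suc j} eq = cong suc (nth-injective p (suc-injective eq))
nth-injective (outside ∷ p)                 eq = nth-injective p (suc-injective eq)

nth-surjective : ∀ {n} {p : Subset n} {x} → x ∈ p → ∃[ i ] nth p i ≡ x
nth-surjective {p = inside  ∷ p} here = zero , refl
nth-surjective {p = inside  ∷ p} (there x∈p) with i , refl ← nth-surjective x∈p = suc i , refl
nth-surjective {p = outside ∷ p} (there x∈p) with i , refl ← nth-surjective x∈p = i , refl

-- `_/_` cancels common factors, so the comparison passes to unnormalised fractions, whose order is
-- cross-multiplication.
/-mono-≤ : ∀ {a c b d} → a * suc d ≤ c * suc b → (+ a / suc b) ≤ℚ (+ c / suc d)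
/-mono-≤ {a} {c} {b} {d} le = ℚ.toℚᵘ-cancel-≤
  (ℚᵘ.≤-trans (ℚᵘ.≤-reflexive (ℚ.toℚᵘ-fromℚᵘ (ℚᵘ.mkℚᵘ (+ a) b)))
  (ℚᵘ.≤-trans (ℚᵘ.*≤* (subst₂ ℤ._≤_ (ℤ.pos-* a (suc d)) (ℤ.pos-* c (suc b)) (+≤+ le)))
              (ℚᵘ.≤-reflexive (ℚᵘ.≃-sym (ℚ.toℚᵘ-fromℚᵘ (ℚᵘ.mkℚᵘ (+ c) d))))))

module _ {n m : ℕ} (G : Graph n m) where
  open Graph G

  -- Edges, walks and distances in spanning subgraphs.

  adjacent-sym : ∀ {S x y} → Adjacent G S x y → Adjacent G S y x
  adjacent-sym (e , e∈ , j) = e , e∈ , swap j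

  joins-unique : ∀ {e x y z w} → Joins e x y → Joins e z w →
                 (x ≡ z × y ≡ w) ⊎ (x ≡ w × y ≡ z)
  joins-unique (inj₁ p) (inj₁ q) with refl ← trans (sym p) q = inj₁ (refl , refl)
  joins-unique (inj₁ p) (inj₂ q) with refl ← trans (sym p) q = inj₂ (refl , refl)
  joins-unique (inj₂ p) (inj₁ q) with refl ← trans (sym p) q = inj₂ (refl , refl)
  joins-unique (inj₂ p) (inj₂ q) with refl ← trans (sym p) q = inj₁ (refl , refl)

  joins-ends : ∀ {e} → Joins e (proj₁ (ends e)) (proj₂ (ends e))
  joins-ends = inj₁ refl

  head∈ : ∀ {S x y k} (w : Walk G S x y k) → x ∈ₗ vertices G w
  head∈ ε       = here refl
  head∈ (_ ◅ _) = here refl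

  last∈ : ∀ {S x y k} (w : Walk G S x y k) → y ∈ₗ vertices G w
  last∈ ε       = here refl
  last∈ (_ ◅ w) = there (last∈ w)

  snoc : ∀ {S x y z k} → Walk G S x y k → Adjacent G S y z → Walk G S x z (suc k)
  snoc ε       a = a ◅ ε
  snoc (b ◅ w) a = b ◅ snoc w a

  unsnoc : ∀ {S x z k} → Walk G S x z (suc k) → ∃[ y ] (Walk G S x y k × Adjacent G S y z)
  unsnoc (a ◅ ε) = _ , ε , a
  unsnoc (a ◅ w@(_ ◅ _)) with y , v , b ← unsnoc w = y , a ◅ v , b

  walk-⊆ : ∀ {S T x y k} → S ⊆ T → Walk G S x y k → Walk G T x y k
  walk-⊆ S⊆T ε                  = ε
  walk-⊆ S⊆T ((e , e∈ , j) ◅ w) = (e , S⊆T e∈ , j) ◅ walk-⊆ S⊆T w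

  -- Inclusion gives one inequality and `shorten` the other; both also transfer reachability, which
  -- settles infinite distances.
  distance-≡ : ∀ {S T x y} → S ⊆ T →
               (∀ {k} → Walk G T x y k → ∃[ j ] (j ≤ k × Walk G S x y j)) →
               distance G T x y ≡ distance G S x y
  distance-≡ {S} {T} {x} {y} S⊆T shorten =
    unique (proj₂ (distance-exists G T x y)) (proj₂ (distance-exists G S x y))
    where
    unique : ∀ {c d} → IsDistance G T x y c → IsDistance G S x y d → c ≡ d
    unique {∞}     {∞}     _         _         = refl
    unique {∞}     {[ _ ]} ¬w        (v , _)   = contradiction (_ , walk-⊆ S⊆T v) ¬w
    unique {[ _ ]} {∞}     (w , _)   ¬v        with _ , _ , v ← shorten w = contradiction (_ , v) ¬v
    unique {[ _ ]} {[ _ ]} (w , min) (v , min′) with _ , j≤ , v′ ← shorten w =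
      cong [_] (≤-antisym (min (walk-⊆ S⊆T v)) (≤-trans (min′ v′) j≤))

  -- Acyclicity from a height function without peaks.

  module Peakless {S : Subset m} (h : Fin n → ℕ)
    (peakless : ∀ {u u′ v} → Adjacent G S u v → Adjacent G S u′ v →
                h u ≤ h v → h u′ ≤ h v → u ≡ u′) where

    -- The step from `p` to `z` does not go down. If the next step did not go up, `z` would be a
    -- peak and `peakless` would put `p` on `w`. So the walk rises all the way, and `q` is the
    -- vertex just before `y`.
    ascend : ∀ {p z y k} → Adjacent G S p z → h p ≤ h z →
             (w : Walk G S z y k) → Unique (vertices G w) → ¬ (p ∈ₗ vertices G w) →
             h z ≤ h y × ∃[ q ] (Adjacent G S q y × h q ≤ h y × (q ≡ p ⊎ q ∈ₗ vertices G w))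
    ascend a p≤z ε u p∉w = ≤-refl , _ , a , p≤z , inj₁ refl
    ascend {z = z} a p≤z (_◅_ {y = z′} b w) (z∉w ∷ u) p∉w with ≤-total (h z) (h z′)
    ... | inj₂ z′≤z = contradiction
      (subst (_∈ₗ _) (sym (peakless a (adjacent-sym b) p≤z z′≤z)) (there (head∈ w))) p∉w
    ... | inj₁ z≤z′ with ascend b z≤z′ w u (λ z∈w → All.lookup z∉w z∈w refl)
    ...   | z′≤y , q , c , q≤y , inj₁ q≡z = ≤-trans z≤z′ z′≤y , q , c , q≤y , inj₂ (here q≡z)
    ...   | z′≤y , q , c , q≤y , inj₂ q∈w = ≤-trans z≤z′ z′≤y , q , c , q≤y , inj₂ (there q∈w)

    -- A walk that ends higher than it starts has a first step that does not go down; from there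
    -- `ascend` applies.
    descend : ∀ {z y k} → h z < h y → (w : Walk G S z y k) → Unique (vertices G w) →
              ∃[ q ] (Adjacent G S q y × h q ≤ h y × q ∈ₗ vertices G w)
    descend z<y ε u = contradiction z<y (<-irrefl refl)
    descend {z} z<y (_◅_ {y = z′} b w) (z∉w ∷ u) with h z ≤? h z′
    ... | no z≰z′ with q , c , q≤y , q∈w ← descend (<-trans (≰⇒> z≰z′) z<y) w u =
      q , c , q≤y , there q∈w
    ... | yes z≤z′ with ascend b z≤z′ w u (λ z∈w → All.lookup z∉w z∈w refl)
    ...   | _ , q , c , q≤y , inj₁ q≡z = q , c , q≤y , here q≡z
    ...   | _ , q , c , q≤y , inj₂ q∈w = q , c , q≤y , there q∈w

    -- Unless `x` or `x₁` is already a peak, the path enters `y` from some `q` after `x` that is no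
    -- higher than `y`. Across the closing edge `x` is no higher than `y` either, which makes `y` a
    -- peak.
    peakless⇒forest : IsForest G S
    peakless⇒forest (_ , _ , _ , ε , _ , () , _)
    peakless⇒forest (_ , _ , _ , _ ◅ ε , _ , s≤s () , _)
    peakless⇒forest (x , y , _ , _◅_ {y = x₁} a (_◅_ {y = x₂} b w) , x∉@(_ All.∷ x∉w) ∷ x₁∉ ∷ u , _ , c)
      with h x ≤? h x₁
    ... | no x≰x₁ = contradiction refl (All.lookup x∉ (subst (_∈ₗ _) q≡x q∈))
      where
      x<y : h x < h y
      x<y with h y ≤? h x
      ... | no  y≰x = ≰⇒> y≰x
      ... | yes y≤x = contradiction (peakless (adjacent-sym a) c (<⇒≤ (≰⇒> x≰x₁)) y≤x)
                                    (All.lookup x₁∉ (last∈ w))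
      found = descend (<-trans (≰⇒> x≰x₁) x<y) (b ◅ w) (x₁∉ ∷ u)
      q∈ = proj₂ (proj₂ (proj₂ found))
      q≡x = peakless (proj₁ (proj₂ found)) (adjacent-sym c) (proj₁ (proj₂ (proj₂ found))) (<⇒≤ x<y)
    ... | yes x≤x₁ with h x₁ ≤? h x₂
    ...   | no x₁≰x₂ = contradiction (peakless a (adjacent-sym b) x≤x₁ (<⇒≤ (≰⇒> x₁≰x₂)))
                                     (All.lookup x∉w (head∈ w))
    ...   | yes x₁≤x₂ with ascend b x₁≤x₂ w u (λ x₁∈w → All.lookup x₁∉ x₁∈w refl)
    ...     | x₂≤y , q , d , q≤y , q∈ = x∉path q∈
      where
      q≡x : q ≡ x
      q≡x = peakless d (adjacent-sym c) q≤y (≤-trans x≤x₁ (≤-trans x₁≤x₂ x₂≤y))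
      x∉path : ¬ (q ≡ x₁ ⊎ q ∈ₗ vertices G w)
      x∉path (inj₁ q≡x₁) = All.lookup x∉ (here refl) (trans (sym q≡x) q≡x₁)
      x∉path (inj₂ q∈w)  = All.lookup x∉w q∈w (sym q≡x)

  module _ (connected : Connected G) where

    -- Edges monitored by a single vertex.

    module From (x : Fin n) where

      height-exists : ∀ y → ∃ (IsMinimum (Walk G ⊤ x y))
      height-exists y = minimum (walk? G x y) (connected x y)

      height : Fin n → ℕ
      height y = proj₁ (height-exists y)

      shortest : ∀ y → Walk G ⊤ x y (height y)
      shortest y = proj₁ (proj₂ (height-exists y))

      height-≤ : ∀ {y k} → Walk G ⊤ x y k → height y ≤ k
      height-≤ {y} = proj₂ (proj₂ (height-exists y))

      -- y can be reached within height z + 1 steps without traversing e from z to y.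
      Detour : Fin m → Fin n → Fin n → Set
      Detour e z y = height y ≤ height z ⊎
        ∃[ f ] ∃[ u ] (f ≢ e × Joins f u y × height u ≤ height z)

      -- The walk is treated from its last edge. If that edge is `e`, the detour restarts from a
      -- shortest walk, which need not be a part of the given one; hence the induction on a bound
      -- `b` for the length.
      reroute : ∀ {e} → (∀ {z y} → Joins e z y → Detour e z y) →
                ∀ b {y k} → k ≤ b → Walk G ⊤ x y k → ∃[ j ] (j ≤ k × Walk G (⊤ - e) x y j)
      reroute detour b {k = zero} _ ε = 0 , z≤n , ε
      reroute {e} detour (suc b) {k = suc k} (s≤s k≤b) w with unsnoc w
      ... | z , v , g , _ , join with g ≟ e
      ...   | no g≢e with j , j≤k , v′ ← reroute detour b k≤b v =
        suc j , s≤s j≤k , snoc v′ (g , x∈p∧x≢y⇒x∈p-y ∈⊤ g≢e , join)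
      ...   | yes refl with detour join
      -- Here `y` is no farther than `z`, so a shortest walk to `y` already beats the walk through
      -- `z`.
      ...     | inj₁ y≤z with j , j≤y , v′ ← reroute detour b
                                (≤-trans y≤z (≤-trans (height-≤ v) k≤b)) (shortest _) =
        j , m≤n⇒m≤1+n (≤-trans j≤y (≤-trans y≤z (height-≤ v))) , v′
      ...     | inj₂ (f , u , f≢e , join′ , u≤z)
                with j , j≤u , v′ ← reroute detour b
                                (≤-trans u≤z (≤-trans (height-≤ v) k≤b)) (shortest u) =
        suc j , s≤s (≤-trans j≤u (≤-trans u≤z (height-≤ v))) ,
        snoc v′ (f , x∈p∧x≢y⇒x∈p-y ∈⊤ f≢e , join′)

      detours⇒¬monitors : ∀ {e u v} → Joins e u v → Detour e u v → Detour e v u →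
                          ¬ Monitors G x e
      detours⇒¬monitors {e} {u} {v} join uv vu (y , d≢) =
        d≢ (distance-≡ (λ _ → ∈⊤) (reroute detour _ ≤-refl))
        where
        detour : ∀ {z y} → Joins e z y → Detour e z y
        detour join′ with joins-unique join join′
        ... | inj₁ (refl , refl) = uv
        ... | inj₂ (refl , refl) = vu

      -- If `u` and `u′` differed, `f` could replace `e` in the direction from `u` to `v`, while the
      -- direction from `v` to `u` gains nothing because `u` is no farther than `v`.
      monitored⇒¬alternative : ∀ {e f u u′ v} → Monitors G x e → Joins e u v → Joins f u′ v →
                               height u ≤ height v → height u′ ≤ height u → u ≡ u′
      monitored⇒¬alternative {e} {f} {u} {u′} mon join join′ u≤v u′≤u with u ≟ u′
      ... | yes u≡u′ = u≡u′
      ... | no  u≢u′ = contradiction mon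
        (detours⇒¬monitors join (inj₂ (f , u′ , f≢e , join′ , u′≤u)) (inj₁ u≤v))
        where
        f≢e : f ≢ e
        f≢e refl with joins-unique join join′
        ... | inj₁ (u≡u′ , _)    = u≢u′ u≡u′
        ... | inj₂ (refl , refl) = u≢u′ refl

      monitored-peakless : ∀ {e f u u′ v} → Monitors G x e → Monitors G x f →
                           Joins e u v → Joins f u′ v →
                           height u ≤ height v → height u′ ≤ height v → u ≡ u′
      monitored-peakless {u = u} {u′} mon mon′ join join′ u≤v u′≤v
        with ≤-total (height u) (height u′)
      ... | inj₁ u≤u′ = sym (monitored⇒¬alternative mon′ join′ join u′≤v u≤u′)
      ... | inj₂ u′≤u = monitored⇒¬alternative mon join join′ u≤v u′≤u

      monitored-forest : ∀ {S} → (∀ {e} → e ∈ S → Monitors G x e) → IsForest G S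
      monitored-forest monitored = Peakless.peakless⇒forest height
        λ (e , e∈ , join) (f , f∈ , join′) → monitored-peakless (monitored e∈) (monitored f∈) join join′

      monitored-≢ : ∀ {e u v} → Monitors G x e → Joins e u v → height u ≢ height v
      monitored-≢ mon join eq = detours⇒¬monitors join
        (inj₁ (≤-reflexive (sym eq))) (inj₁ (≤-reflexive eq)) mon

      orient : ∀ {e} → Monitors G x e → ∃[ u ] ∃[ v ] (Joins e u v × height u < height v)
      orient {e} mon with <-cmp (height (proj₁ (ends e))) (height (proj₂ (ends e)))
      ... | tri< lt _ _ = _ , _ , joins-ends , lt
      ... | tri≈ _ eq _ = contradiction eq (monitored-≢ mon joins-ends)
      ... | tri> _ _ gt = _ , _ , swap joins-ends , gt

      -- The empty walk gives `x` height 0, below which no vertex lies.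
      source-lowest : ∀ {u v} → height u < height v → x ≢ v
      source-lowest u<v refl with height x | height-≤ {x} ε
      source-lowest () refl | _ | z≤n

    -- Covering all edges by forests, one for each source.

    module Cover {k : ℕ} (source : Fin k → Fin n) (monitored : ∀ e → ∃[ i ] Monitors G (source i) e) where

      -- Several sources may monitor the same edge; fixing one of them makes the classes disjoint.
      monitor : Fin m → Fin k
      monitor e = proj₁ (monitored e)

      forestPartition : ForestPartition G k
      forestPartition = Vec.tabulate monitor , λ i → From.monitored-forest (source i)
        λ {e} e∈ → subst (λ j → Monitors G (source j) e) (∈-part e∈) (proj₂ (monitored e))
        where
        ∈-part : ∀ {e i} → e ∈ part G (Vec.tabulate monitor) i → monitor e ≡ i
        ∈-part {e} {i} e∈ with monitor e ≟ i | does≡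
          where
          does≡ : does (monitor e ≟ i) ≡ true
          does≡ = begin
            does (monitor e ≟ i)                               ≡⟨ cong (λ j → does (j ≟ i)) (lookup∘tabulate monitor e) ⟨
            does (Vec.lookup (Vec.tabulate monitor) e ≟ i)     ≡⟨ lookup-map e _ (Vec.tabulate monitor) ⟨
            Vec.lookup (part G (Vec.tabulate monitor) i) e     ≡⟨ []=⇒lookup e∈ ⟩
            true                                               ∎
            where open ≡-Reasoning
        ... | yes eq | _ = eq
        ... | no  _  | ()

      private module F (i : Fin k) = From (source i)

      -- Stars of monitored edges inside a clique.

      module _ {l : ℕ} (c : Fin l → Fin n) (clique : ∀ {a b} → a ≢ b → Adjacent G ⊤ (c a) (c b)) where

        Centre : Fin k → Fin l → Set
        Centre i a = ∀ b → b ≢ a → F.height i (c a) < F.height i (c b)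

        centre? : ∀ i a → Dec (Centre i a)
        centre? i a = all? λ b → ¬? (b ≟ a) →-dec (F.height i (c a) <? F.height i (c b))

        centre-unique : ∀ {i a b} → Centre i a → Centre i b → a ≡ b
        centre-unique {a = a} {b} ca cb with a ≟ b
        ... | yes a≡b = a≡b
        ... | no  a≢b = contradiction (<-trans (ca b (a≢b ∘ sym)) (cb a a≢b)) (<-irrefl refl)

        -- Were another clique vertex `c d` no higher than `c a`, its edge to `c b` would be an
        -- alternative to `e`. This forces `c a ≡ c d`, and the clique edge between these two would
        -- be a loop.
        lower-centre : ∀ {e i a b} → Monitors G (source i) e → Joins e (c a) (c b) →
                       F.height i (c a) < F.height i (c b) → Centre i a
        lower-centre {i = i} {a} {b} mon join a<b d d≢a with d ≟ b
        ... | yes refl = a<b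
        ... | no  d≢b with F.height i (c d) ≤? F.height i (c a)
        ...   | no  d≰a = ≰⇒> d≰a
        ...   | yes d≤a with _ , _ , join″ ← clique (d≢a ∘ sym) | _ , _ , join′ ← clique d≢b =
          contradiction (subst (Joins _ (c a)) (sym (F.monitored⇒¬alternative i mon join join′ (<⇒≤ a<b) d≤a)) join″)
                        loopless

        edge-centre : ∀ {a b} → a ≢ b → ∃[ i ] (Centre i a ⊎ Centre i b)
        edge-centre {a} {b} a≢b with clique a≢b
        ... | e , _ , join with monitored e
        ...   | i , mon with <-cmp (F.height i (c a)) (F.height i (c b))
        ...     | tri< lt _ _ = i , inj₁ (lower-centre mon join lt)
        ...     | tri≈ _ eq _ = contradiction eq (F.monitored-≢ i mon join)
        ...     | tri> _ _ gt = i , inj₂ (lower-centre mon (swap join) gt)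

        centres-injective : ∀ {l′} {g : Fin l′ → Fin l} → Injective _≡_ _≡_ g →
                            (∀ a → ∃[ i ] Centre i (g a)) → l′ ≤ k
        centres-injective g-injective centre = injective⇒≤ {f = proj₁ ∘ centre} λ {a} {b} eq →
          g-injective (centre-unique (subst (λ i → Centre i _) eq (proj₂ (centre a))) (proj₂ (centre b)))

      -- If `r` is not a centre, its edge to any other vertex makes that vertex a centre, and
      -- distinct centres belong to distinct sources.
      clique-≤ : ∀ {l} (c : Fin l → Fin n) → (∀ {a b} → a ≢ b → Adjacent G ⊤ (c a) (c b)) → l ≤ suc k
      clique-≤ {zero}  c clique = z≤n
      clique-≤ {suc l} c clique with all? (λ a → any? λ i → centre? c clique i a)
      ... | yes centre  = m≤n⇒m≤1+n (centres-injective c clique (λ eq → eq) centre)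
      ... | no  ¬centre with r , r-free ← ¬∀⟶∃¬ _ _ (λ a → any? λ i → centre? c clique i a) ¬centre =
        s≤s (centres-injective c clique (punchIn-injective r _ _) centre)
        where
        centre : ∀ a → ∃[ i ] Centre c clique i (punchIn r a)
        centre a with edge-centre c clique (punchInᵢ≢i r a)
        ... | i , inj₁ ci = i , ci
        ... | i , inj₂ cr = contradiction (i , cr) r-free

-- Counting edges.

open Graph using (Joins; noParallel)

-- An edge is encoded by its source and its upper end. The upper end is never the source, so
-- `punchOut` leaves `n` values for it.
edges-≤ : ∀ {n m k} (G : Graph (suc n) m) (connected : Connected G) (source : Fin k → Fin (suc n)) →
          (∀ e → ∃[ i ] Monitors G (source i) e) → m ≤ k * n
edges-≤ {n} {m} {k} G connected source monitored = injective⇒≤ {f = f} f-injective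
  where
  module F (i : Fin k) = From G connected (source i)

  monitor : Fin m → Fin k
  monitor e = proj₁ (monitored e)

  oriented : ∀ e → ∃[ u ] ∃[ v ] (Joins G e u v × F.height (monitor e) u < F.height (monitor e) v)
  oriented e = F.orient (monitor e) (proj₂ (monitored e))

  upper : Fin m → Fin (suc n)
  upper e = proj₁ (proj₂ (oriented e))

  source≢upper : ∀ e → source (monitor e) ≢ upper e
  source≢upper e = F.source-lowest (monitor e) (proj₂ (proj₂ (proj₂ (oriented e))))

  f : Fin m → Fin (k * n)
  f e = combine (monitor e) (punchOut (source≢upper e))

  -- A common source and upper end force a common lower end, as there are no peaks. The indices `i`
  -- and `j` are variables so that their equality can be matched with `refl`.
  determined : ∀ {i j e e′ u u′ v v′} (≢v : source i ≢ v) (≢v′ : source j ≢ v′) →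
               Monitors G (source i) e → Monitors G (source j) e′ → Joins G e u v → Joins G e′ u′ v′ →
               F.height i u < F.height i v → F.height j u′ < F.height j v′ →
               i ≡ j → punchOut ≢v ≡ punchOut ≢v′ → e ≡ e′
  determined ≢v ≢v′ mon mon′ join join′ u<v u′<v′ refl eq
    with refl ← punchOut-injective ≢v ≢v′ eq
    with refl ← F.monitored-peakless _ mon mon′ join join′ (<⇒≤ u<v) (<⇒≤ u′<v′) = noParallel G join join′

  f-injective : Injective _≡_ _≡_ f
  f-injective {e} {e′} eq with i≡j , out≡ ← combine-injective (monitor e) _ (monitor e′) _ eq =
    let _ , _ , join  , lt  = oriented e
        _ , _ , join′ , lt′ = oriented e′
    in determined (source≢upper e) (source≢upper e′) (proj₂ (monitored e)) (proj₂ (monitored e′))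
         join join′ lt lt′ i≡j out≡

-- Assembling the three bounds.

edge-exists : ∀ {n m} (G : Graph (suc (suc n)) m) → Connected G → Fin m
edge-exists G connected with connected zero (suc zero)
... | _ , (e , _) ◅ _ = e

module _ {n m k : ℕ} (G : Graph (suc (suc n)) m) (connected : Connected G) where

  monitoring-bounds : MonitoringSetOfSize G k →
    ForestPartition G k × m ≤ k * suc n × (∀ {l} → CliqueOfSize G l → l ≤ 2 * k)
  monitoring-bounds (M , refl , monitoring) =
    Cover.forestPartition G connected source monitored ,
    edges-≤ G connected source monitored ,
    λ { (C , refl , clique) → ≤-trans
          (Cover.clique-≤ G connected source monitored (nth C)
            λ a≢b → clique _ _ (nth∈ C _) (nth∈ C _) (a≢b ∘ nth-injective C))
          -- The bound `1 + k` is at most `2 * k` because `M` is nonempty; `2 * k` unfolds to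
          -- `k + (k + 0)`.
          (+-mono-≤ 1≤∣M∣ (m≤m+n ∣ M ∣ 0)) }
    where
    source : Fin ∣ M ∣ → Fin (suc (suc n))
    source = nth M

    monitored : ∀ e → ∃[ i ] Monitors G (source i) e
    monitored e with x , x∈M , mon ← monitoring e with i , refl ← nth-surjective x∈M = i , mon

    inhabited⇒1≤ : ∀ {l} → Fin l → 1 ≤ l
    inhabited⇒1≤ {suc _} _ = s≤s z≤n

    1≤∣M∣ : 1 ≤ ∣ M ∣
    -- A connected graph on at least two vertices has an edge, and `M` contains a vertex monitoring
    -- it.
    1≤∣M∣ = inhabited⇒1≤ (proj₁ (monitored (edge-exists G connected)))

theorem11 : ∀ {n m : ℕ} (G : Graph n m) (2≤n : 2 ≤ n) → Connected G →
    arb G ≤ dem G ×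
    (_/_ (+ m) (n ∸ 1) {{n∸1-nonZero 2≤n}}) ≤ℚ (+ dem G / 1) ×
    (+ ω G / 2) ≤ℚ (+ dem G / 1)
theorem11 {suc (suc n)} {m} G (s≤s (s≤s z≤n)) connected =
  let partition , edges , cliques = monitoring-bounds G connected (proj₁ (proj₂ (dem-exists G)))
  in proj₂ (proj₂ (arb-exists G)) partition ,
     -- Denominators are passed as their predecessors; `n` is now two less than the number of
     -- vertices.
     /-mono-≤ {m} {dem G} {n} {0} (subst (_≤ dem G * suc n) (sym (*-identityʳ m)) edges) ,
     /-mono-≤ {ω G} {dem G} {1} {0} (subst₂ _≤_ (sym (*-identityʳ (ω G))) (*-comm 2 (dem G))
       (cliques (proj₁ (proj₂ (ω-exists G)))))
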